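{- Suppose $G$ is a $(p,j)$-jumbled graph of density $p$, where $j > 0$. Then \[ f(G) \geq \frac{\mathrm{disc}^+(G)}{j}. \]
   Context: Graphs are finite and simple. The density of a graph $G$ on $n \geq 2$ vertices is $p = |E(G)|/\binom{n}{2}$. A full subgraph of a graph $G$ of density $p$ is an $m$-vertex subgraph $H$ of $G$ of minimum degree at least $p(m-1)$; $f(G)$ denotes the largest number of vertices in a full subgraph of $G$. For $X \subseteq V(G)$, $e(X)$ is the number of edges of $G$ lying in $X$, and $\delta_p(X) = e(X) - p\binom{|X|}{2}$. For a graph $G$ of density $p$, the positive discrepancy is $\mathrm{disc}^+(G) = \max_{X \subseteq V(G)} \delta_p(X)$. A graph $G$ is $(p,j)$-jumbled if $|\delta_p(X)| \leq j|X|$ for every $X \subseteq V(G)$. -}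

module Defs where

open import Data.Empty using (⊥; ⊥-elim)
open import Data.Fin.Base as Fin using (Fin)
import Data.Fin.Properties as Fin
open import Data.Fin.Subset using (Subset; inside; outside; _∈_) renaming (∣_∣ to card)
open import Data.Fin.Subset.Properties using (_∈?_; anySubset?)
open import Data.Integer.Base as ℤ using (+_)
import Data.Integer.Properties as ℤ
open import Data.List.Base using (List; []; _∷_; length; filter; allFin; cartesianProduct)
open import Data.Nat.Base as ℕ using (ℕ; zero; suc)
import Data.Nat.Properties as ℕ
open import Data.Nat.Combinatorics using (_C_; nCk+nC[k+1]≡[n+1]C[k+1]; nC1≡n)
open import Data.Product.Base using (Σ; ∃; ∃₂; _×_; _,_; proj₁; proj₂; uncurry)
open import Data.Rational.Base
open import Data.Rational.Properties
open import Data.Sum.Base using (_⊎_; inj₁; inj₂)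
open import Data.Vec.Base using ([]; _∷_)
open import Level using (Level; 0ℓ)
open import Relation.Binary.Core using (Rel)
open import Relation.Binary.Definitions using (Decidable; Irreflexive; Symmetric; tri<; tri≈; tri>)
open import Relation.Binary.PropositionalEquality using (_≡_; refl; sym; trans; cong; subst; module ≡-Reasoning)
open import Relation.Nullary.Decidable using (yes; no; _×-dec_; _→-dec_; map′)
open import Relation.Nullary.Negation.Core using (¬_)
import Relation.Unary as U

private
  variable
    n : ℕ
    ℓ : Level

-- Real numbers: two-sided located Dedekind cuts of ℚ.

record ℝ : Set₁ where
  field
    L U         : ℚ → Set
    L-inhabited : ∃ L
    U-inhabited : ∃ U
    L-lower     : ∀ {q r} → q < r → L r → L q
    U-upper     : ∀ {q r} → q < r → U q → U r
    L-open      : ∀ {q} → L q → ∃ λ r → q < r × L r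
    U-open      : ∀ {r} → U r → ∃ λ q → q < r × U q
    disjoint    : ∀ {q} → L q → U q → ⊥
    located     : ∀ {q r} → q < r → L q ⊎ U r

  L<U : ∀ {q r} → L q → U r → q < r
  L<U {q} {r} l u with <-cmp q r
  ... | tri< q<r _ _ = q<r
  ... | tri≈ _ q≡r _ = ⊥-elim (disjoint l (subst U (sym q≡r) u))
  ... | tri> _ _ r<q = ⊥-elim (disjoint l (U-upper r<q u))

open ℝ

infix 4 _≤ᴿ_ _<ᴿ_ _≥ᴿ_

_≤ᴿ_ : ℝ → ℝ → Set
x ≤ᴿ y = ∀ q → L x q → L y q

_≥ᴿ_ : ℝ → ℝ → Set
x ≥ᴿ y = y ≤ᴿ x

_<ᴿ_ : ℝ → ℝ → Set
x <ᴿ y = ∃ λ q → U x q × L y q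

private
  pred< : ∀ q → q - 1ℚ < q
  pred< q = subst (q - 1ℚ <_) (+-identityʳ q) (+-monoʳ-< q (*<* ℤ.-<+))

  <suc : ∀ q → q < q + 1ℚ
  <suc q = subst (_< q + 1ℚ) (+-identityʳ q) (+-monoʳ-< q (*<* (ℤ.+<+ (ℕ.s≤s ℕ.z≤n))))

  0<1 : 0ℚ < 1ℚ
  0<1 = *<* (ℤ.+<+ (ℕ.s≤s ℕ.z≤n))

  <-⊓ : ∀ {q a b} → q < a → q < b → q < a ⊓ b
  <-⊓ {q} {a} {b} q<a q<b with ⊓-sel a b
  ... | inj₁ e = subst (q <_) (sym e) q<a
  ... | inj₂ e = subst (q <_) (sym e) q<b

  ⊔-< : ∀ {q a b} → a < q → b < q → a ⊔ b < q
  ⊔-< {q} {a} {b} a<q b<q with ⊔-sel a b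
  ... | inj₁ e = subst (_< q) (sym e) a<q
  ... | inj₂ e = subst (_< q) (sym e) b<q

fromℚ : ℚ → ℝ
fromℚ c .L q = q < c
fromℚ c .U q = c < q
fromℚ c .L-inhabited = c - 1ℚ , pred< c
fromℚ c .U-inhabited = c + 1ℚ , <suc c
fromℚ c .L-lower = <-trans
fromℚ c .U-upper q<r c<q = <-trans c<q q<r
fromℚ c .L-open q<c with r , q<r , r<c ← <-dense q<c = r , q<r , r<c
fromℚ c .U-open c<r with q , c<q , q<r ← <-dense c<r = q , q<r , c<q
fromℚ c .disjoint q<c c<q = <-asym q<c c<q
fromℚ c .located {q} q<r with q <? c
... | yes q<c = inj₁ q<c
... | no  q≮c = inj₂ (≤-<-trans (≮⇒≥ q≮c) q<r)

0ᴿ : ℝ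
0ᴿ = fromℚ 0ℚ

private
  divide : ∀ c .{{_ : NonZero c}} q → c * (1/ c * q) ≡ q
  divide c q = begin
    c * (1/ c * q)  ≡⟨ *-assoc c (1/ c) q ⟨
    c * 1/ c * q    ≡⟨ cong (_* q) (*-inverseʳ c) ⟩
    1ℚ * q          ≡⟨ *-identityˡ q ⟩
    q               ∎
    where open ≡-Reasoning

infixr 7 _·_

-- The product of a rational and a real: q is below c · x iff it is below c * y
-- for all y in some rational interval (a , b) around x, and such linear
-- functions are bounded on the interval by their values at the ends.
_·_ : ℚ → ℝ → ℝ
(c · x) .L q = ∃₂ λ a b → L x a × U x b × q < c * a × q < c * b
(c · x) .U q = ∃₂ λ a b → L x a × U x b × c * a < q × c * b < q
(c · x) .L-inhabited with a , la ← L-inhabited x | b , ub ← U-inhabited x =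
  ((c * a) ⊓ (c * b)) - 1ℚ , a , b , la , ub ,
  <-≤-trans (pred< _) (p⊓q≤p (c * a) (c * b)) , <-≤-trans (pred< _) (p⊓q≤q (c * a) (c * b))
(c · x) .U-inhabited with a , la ← L-inhabited x | b , ub ← U-inhabited x =
  ((c * a) ⊔ (c * b)) + 1ℚ , a , b , la , ub ,
  ≤-<-trans (p≤p⊔q (c * a) (c * b)) (<suc _) , ≤-<-trans (p≤q⊔p (c * a) (c * b)) (<suc _)
(c · x) .L-lower q<r (a , b , la , ub , ra , rb) =
  a , b , la , ub , <-trans q<r ra , <-trans q<r rb
(c · x) .U-upper q<r (a , b , la , ub , qa , qb) =
  a , b , la , ub , <-trans qa q<r , <-trans qb q<r
(c · x) .L-open (a , b , la , ub , qa , qb) with r , q<r , r< ← <-dense (<-⊓ qa qb) =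
  r , q<r , a , b , la , ub ,
  <-≤-trans r< (p⊓q≤p (c * a) (c * b)) , <-≤-trans r< (p⊓q≤q (c * a) (c * b))
(c · x) .U-open (a , b , la , ub , qa , qb) with r , <r , r<q ← <-dense (⊔-< qa qb) =
  r , r<q , a , b , la , ub ,
  ≤-<-trans (p≤p⊔q (c * a) (c * b)) <r , ≤-<-trans (p≤q⊔p (c * a) (c * b)) <r
(c · x) .disjoint {q} (a , b , la , ub , qa , qb) (a′ , b′ , la′ , ub′ , qa′ , qb′)
  with ≤-total 0ℚ c
... | inj₁ 0≤c = <-irrefl refl (<-trans (<-≤-trans qa
      (*-monoˡ-≤-nonNeg c {{nonNegative 0≤c}} (<⇒≤ (L<U x la ub′)))) qb′)
... | inj₂ c≤0 = <-irrefl refl (<-trans (<-≤-trans qb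
      (*-monoˡ-≤-nonPos c {{nonPositive c≤0}} (<⇒≤ (L<U x la′ ub)))) qa′)
(c · x) .located {q} {r} q<r with <-cmp c 0ℚ
... | tri≈ _ refl _ with a , la ← L-inhabited x | b , ub ← U-inhabited x | q <? 0ℚ
...   | yes q<0 = inj₁ (a , b , la , ub ,
        subst (q <_) (sym (*-zeroˡ a)) q<0 , subst (q <_) (sym (*-zeroˡ b)) q<0)
...   | no  q≮0 = inj₂ (a , b , la , ub ,
        subst (_< r) (sym (*-zeroˡ a)) (≤-<-trans (≮⇒≥ q≮0) q<r) ,
        subst (_< r) (sym (*-zeroˡ b)) (≤-<-trans (≮⇒≥ q≮0) q<r))
(c · x) .located {q} {r} q<r | tri> _ _ 0<c = go
  where
  instance
    _ = positive 0<c
    _ = pos⇒nonZero c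
    _ = 1/pos⇒pos c
  go : (c · x) .L q ⊎ (c · x) .U r
  go with s , q<s , s<r ← <-dense (*-monoʳ-<-pos (1/ c) q<r)
     with t , s<t , t<r ← <-dense s<r
     with located x s<t
  ... | inj₁ ls with b , ub ← U-inhabited x =
        inj₁ (s , b , ls , ub , qs , <-trans qs (*-monoʳ-<-pos c (L<U x ls ub)))
    where qs = subst (_< c * s) (divide c q) (*-monoʳ-<-pos c q<s)
  ... | inj₂ ut with a , la ← L-inhabited x =
        inj₂ (a , t , la , ut , <-trans (*-monoʳ-<-pos c (L<U x la ut)) tr , tr)
    where tr = subst (c * t <_) (divide c r) (*-monoʳ-<-pos c t<r)
(c · x) .located {q} {r} q<r | tri< c<0 _ _ = go
  where
  instance
    _ = negative c<0
    _ = neg⇒nonZero c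
    _ = 1/neg⇒neg c
  go : (c · x) .L q ⊎ (c · x) .U r
  go with s , r<s , s<q ← <-dense (*-monoʳ-<-neg (1/ c) q<r)
     with t , s<t , t<q ← <-dense s<q
     with located x s<t
  ... | inj₁ ls with b , ub ← U-inhabited x =
        inj₂ (s , b , ls , ub , sr , <-trans (*-monoʳ-<-neg c (L<U x ls ub)) sr)
    where sr = subst (c * s <_) (divide c r) (*-monoʳ-<-neg c r<s)
  ... | inj₂ ut with a , la ← L-inhabited x =
        inj₁ (a , t , la , ut , <-trans qt (*-monoʳ-<-neg c (L<U x la ut)) , qt)
    where qt = subst (_< c * t) (divide c q) (*-monoʳ-<-neg c t<q)

-- The reciprocal of a positive real: q < 1/x iff q * r < 1 for some rational r > x.
recip : (x : ℝ) → 0ᴿ <ᴿ x → ℝ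
recip x (s , 0<s , ls) = record
  { L = λ q → ∃ λ r → U x r × q * r < 1ℚ
  ; U = λ q → ∃ λ r → 0ℚ < r × L x r × 1ℚ < q * r
  ; L-inhabited = let b , ub = U-inhabited x in
      0ℚ , b , ub , subst (_< 1ℚ) (sym (*-zeroˡ b)) 0<1
  ; U-inhabited = 1/s + 1ℚ , s , 0<s , ls , subst (_< (1/s + 1ℚ) * s) (*-inverseˡ s {{nz}})
      (*-monoˡ-<-pos s {{positive 0<s}} (<suc 1/s))
  ; L-lower = λ q<q′ (r , ur , lt) →
      r , ur , <-trans (*-monoˡ-<-pos r {{positive (0<U ur)}} q<q′) lt
  ; U-upper = λ q<q′ (r , 0<r , lr , lt) →
      r , 0<r , lr , <-trans lt (*-monoˡ-<-pos r {{positive 0<r}} q<q′)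
  ; L-open = λ {q} (r , ur , qr<1) →
      let m , qr<m , m<1 = <-dense qr<1
          q′ , eq = quotient m r (0<U ur)
      in q′ , cancel r (0<U ur) (subst (q * r <_) (sym eq) qr<m) ,
         r , ur , subst (_< 1ℚ) (sym eq) m<1
  ; U-open = λ {q} (r , 0<r , lr , 1<qr) →
      let m , 1<m , m<qr = <-dense 1<qr
          q′ , eq = quotient m r 0<r
      in q′ , cancel r 0<r (subst (_< q * r) (sym eq) m<qr) ,
         r , 0<r , lr , subst (1ℚ <_) (sym eq) 1<m
  ; disjoint = λ {q} → disj q
  ; located = loc
  }
  where
  nz : NonZero s
  nz = pos⇒nonZero s {{positive 0<s}}

  1/s : ℚ
  1/s = (1/ s) {{nz}}

  0<U : ∀ {r} → U x r → 0ℚ < r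
  0<U ur = <-trans 0<s (L<U x ls ur)

  cancel : ∀ {p q} r → 0ℚ < r → p * r < q * r → p < q
  cancel r 0<r = *-cancelʳ-<-nonNeg r {{nonNegative (<⇒≤ 0<r)}}

  quotient : ∀ m r → 0ℚ < r → ∃ λ q → q * r ≡ m
  quotient m r 0<r = 1/ r * m , trans (*-comm (1/ r * m) r) (divide r m)
    where instance _ = pos⇒nonZero r {{positive 0<r}}

  disj : ∀ q → (∃ λ r → U x r × q * r < 1ℚ) → (∃ λ r → 0ℚ < r × L x r × 1ℚ < q * r) → ⊥
  disj q (r , ur , qr<1) (r′ , 0<r′ , lr′ , 1<qr′) = <-irrefl refl
    (<-trans 1<qr′ (<-trans (*-monoʳ-<-pos q {{positive 0<q}} (L<U x lr′ ur)) qr<1))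
    where
    0<q : 0ℚ < q
    0<q = cancel r′ 0<r′ (subst (_< q * r′) (sym (*-zeroˡ r′)) (<-trans 0<1 1<qr′))

  loc : ∀ {q q′} → q < q′ →
        (∃ λ r → U x r × q * r < 1ℚ) ⊎ (∃ λ r → 0ℚ < r × L x r × 1ℚ < q′ * r)
  loc {q} {q′} q<q′ with 0ℚ <? q
  ... | no 0≮q = let b , ub = U-inhabited x in inj₁ (b , ub , ≤-<-trans
          (subst (q * b ≤_) (*-zeroˡ b)
            (*-monoʳ-≤-nonNeg b {{nonNegative (<⇒≤ (0<U ub))}} (≮⇒≥ 0≮q))) 0<1)
  ... | yes 0<q = go
    where
    0<q′ : 0ℚ < q′
    0<q′ = <-trans 0<q q<q′
    instance
      posq = positive 0<q
      posq′ = positive 0<q′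
      nzq = pos⇒nonZero q
      nzq′ = pos⇒nonZero q′
      posi = 1/pos⇒pos q
      posi′ = 1/pos⇒pos q′
    1/q′<1/q : 1/ q′ < 1/ q
    1/q′<1/q = *-cancelˡ-<-nonNeg q {{pos⇒nonNeg q}} (subst (q * 1/ q′ <_) (sym (*-inverseʳ q))
      (subst (q * 1/ q′ <_) (*-inverseʳ q′) (*-monoˡ-<-pos (1/ q′) q<q′)))
    go : _
    go with t , <t , t<1/q ← <-dense 1/q′<1/q
       with u , <u , u<t ← <-dense <t
       with located x u<t
    ... | inj₁ lu = inj₂ (u , <-trans (positive⁻¹ (1/ q′)) <u , lu ,
            subst (_< q′ * u) (*-inverseʳ q′) (*-monoʳ-<-pos q′ <u))
    ... | inj₂ ut = inj₁ (t , ut , subst (q * t <_) (*-inverseʳ q) (*-monoʳ-<-pos q t<1/q))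

infixl 7 _÷ᴿ_⟨_⟩

_÷ᴿ_⟨_⟩ : ℚ → (x : ℝ) → 0ᴿ <ᴿ x → ℝ
c ÷ᴿ x ⟨ x>0 ⟩ = c · recip x x>0

fromℕ : ℕ → ℚ
fromℕ m = + m / 1

record Graph (n : ℕ) : Set₁ where
  field
    Adj    : Rel (Fin n) 0ℓ
    adj?   : Decidable Adj
    symm   : Symmetric Adj
    irrefl : Irreflexive _≡_ Adj

module _ (G : Graph n) where
  open Graph G

  -- Each edge is listed once, as the pair of its ends in increasing order.
  edges : List (Fin n × Fin n)
  edges = filter (λ (u , v) → (u Fin.<? v) ×-dec adj? u v) (cartesianProduct (allFin n) (allFin n))

  e : Subset n → ℕ
  e X = length (filter (λ (u , v) → (u ∈? X) ×-dec (v ∈? X)) edges)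

nC2≢0 : ∀ n .{{_ : ℕ.NonTrivial n}} → ℕ.NonZero (n C 2)
nC2≢0 (suc (suc m)) =
  subst ℕ.NonZero (nCk+nC[k+1]≡[n+1]C[k+1] (suc m) 1)
    (subst (λ k → ℕ.NonZero (k ℕ.+ suc m C 2)) (sym (nC1≡n (suc m))) _)

density : .{{ℕ.NonTrivial n}} → Graph n → ℚ
density {n} G = (+ length (edges G) / (n C 2)) {{nC2≢0 n}}

δ : Graph n → ℚ → Subset n → ℚ
δ G p X = fromℕ (e G X) - p * fromℕ (card X C 2)

maxSubset : (Subset n → ℚ) → ℚ
maxSubset {zero}  g = g []
maxSubset {suc n} g = maxSubset (λ X → g (inside ∷ X)) ⊔ maxSubset (λ X → g (outside ∷ X))

disc⁺ : .{{ℕ.NonTrivial n}} → Graph n → ℚ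
disc⁺ G = maxSubset (δ G (density G))

Jumbled : ℚ → ℝ → Graph n → Set
Jumbled p j G = ∀ X → fromℚ ∣ δ G p X ∣ ≤ᴿ fromℕ (card X) · j

degree : {R : Rel (Fin n) 0ℓ} → Decidable R → Fin n → ℕ
degree {n} R? v = length (filter (R? v) (allFin n))

-- Subgraphs need not be induced.
record Subgraph (G : Graph n) : Set₁ where
  field
    V     : Subset n
    Adjᴴ  : Rel (Fin n) 0ℓ
    adjᴴ? : Decidable Adjᴴ
    symᴴ  : Symmetric Adjᴴ
    ⊆G    : ∀ {u v} → Adjᴴ u v → Graph.Adj G u v
    ends  : ∀ {u v} → Adjᴴ u v → u ∈ V × v ∈ V

  order : ℕ
  order = card V

open Subgraph

MinDegree≥ : {G : Graph n} → Subgraph G → ℚ → Set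
MinDegree≥ H d = ∀ v → v ∈ V H → d ≤ fromℕ (degree (adjᴴ? H) v)

Full : .{{ℕ.NonTrivial n}} → {G : Graph n} → Subgraph G → Set
Full {G = G} H = MinDegree≥ H (density G * (fromℕ (order H) - 1ℚ))

HasFull : .{{ℕ.NonTrivial n}} → Graph n → ℕ → Set₁
HasFull G m = Σ (Subgraph G) λ H → Full H × order H ≡ m

induced : (G : Graph n) → Subset n → Subgraph G
induced G X = record
  { V     = X
  ; Adjᴴ  = λ u v → u ∈ X × v ∈ X × Graph.Adj G u v
  ; adjᴴ? = λ u v → (u ∈? X) ×-dec (v ∈? X) ×-dec Graph.adj? G u v
  ; symᴴ  = λ (u∈X , v∈X , uv) → v∈X , u∈X , Graph.symm G uv
  ; ⊆G    = λ (_ , _ , uv) → uv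
  ; ends  = λ (u∈X , v∈X , _) → u∈X , v∈X
  }

private
  length-filter-mono : ∀ {A : Set} {P Q : A → Set} (P? : U.Decidable P) (Q? : U.Decidable Q) →
                       (∀ {x} → P x → Q x) → ∀ xs → length (filter P? xs) ℕ.≤ length (filter Q? xs)
  length-filter-mono P? Q? P⇒Q [] = ℕ.z≤n
  length-filter-mono P? Q? P⇒Q (x ∷ xs) with ih ← length-filter-mono P? Q? P⇒Q xs | P? x | Q? x
  ... | yes px | yes qx = ℕ.s≤s ih
  ... | yes px | no ¬qx = ⊥-elim (¬qx (P⇒Q px))
  ... | no  _  | yes _  = ℕ.m≤n⇒m≤1+n ih
  ... | no  _  | no  _  = ih

  fromℕ-mono : ∀ {a b} → a ℕ.≤ b → fromℕ a ≤ fromℕ b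
  fromℕ-mono {a} {b} a≤b = toℚᵘ-cancel-≤
    (ℚᵘ.≤-respˡ-≃ (ℚᵘ.≃-sym (toℚᵘ-fromℚᵘ (mkℚᵘ (+ a) 0)))
      (ℚᵘ.≤-respʳ-≃ (ℚᵘ.≃-sym (toℚᵘ-fromℚᵘ (mkℚᵘ (+ b) 0)))
        (*≤* (ℤ.*-monoʳ-≤-nonNeg (+ 1) (ℤ.+≤+ a≤b)))))
    where
    open import Data.Rational.Unnormalised.Base using (mkℚᵘ; *≤*)
    import Data.Rational.Unnormalised.Properties as ℚᵘ

-- It suffices to look for induced full subgraphs, of which there are finitely many.
hasFull? : .{{_ : ℕ.NonTrivial n}} (G : Graph n) → U.Decidable (HasFull G)
hasFull? G m = map′ (λ (X , full , eq) → induced G X , full , eq)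
  (λ (H , full , eq) → V H , (λ v v∈ → ≤-trans (full v v∈) (fromℕ-mono (length-filter-mono
      (adjᴴ? H v) (adjᴴ? (induced G (V H)) v)
      (λ vu → proj₁ (ends H vu) , proj₂ (ends H vu) , ⊆G H vu) (allFin _)))) , eq)
  (anySubset? λ X →
    Fin.all? (λ v → (v ∈? X) →-dec (_ ≤? _)) ×-dec (card X ℕ.≟ m))

largest≤ : {P : ℕ → Set ℓ} → U.Decidable P → ℕ → ℕ
largest≤ P? zero = zero
largest≤ P? (suc b) with P? (suc b)
... | yes _ = suc b
... | no  _ = largest≤ P? b

-- A single vertex is always a full subgraph, so the default value 0 of the search is never reached.
f : .{{ℕ.NonTrivial n}} → Graph n → ℕ
f {n} G = largest≤ (hasFull? G) n

{-# OPTIONS --safe #-}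
module Submission where

-- If X maximises δₚ, then removing v ∈ X cannot increase δₚ; as
-- δₚ(X) − δₚ(X − v) = deg_X(v) − p(|X| − 1), the subgraph induced by X is full.
-- Jumbledness gives disc⁺(G) = δₚ(X) ≤ j|X| ≤ j f(G).

open import Defs
open import Data.Nat.Base using (ℕ; NonTrivial)
open import Data.Fin.Base as Fin using (Fin)
import Data.Fin.Properties as Fin
open import Data.Fin.Subset using (Subset; inside; outside; _∈_; _-_; ⊥) renaming (∣_∣ to card)
open import Data.Fin.Subset.Properties using (_∈?_; x∈p∧x≢y⇒x∈p-y; ∣⊥∣≡0; ∣p∣≤n; p─⊥≡p)
open import Data.Integer.Base as ℤ using (+_)
import Data.Integer.Properties as ℤ
open import Data.List.Base using (List; []; _∷_; _++_; length; filter; allFin; map; cartesianProduct)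
open import Data.List.Properties using (length-++; length-map)
open import Data.List.Membership.Propositional using () renaming (_∈_ to _∈ˡ_)
open import Data.List.Membership.Propositional.Properties
  using (∈-filter⁺; ∈-filter⁻; ∈-map⁺; ∈-++⁺ˡ; ∈-++⁺ʳ; ∈-++⁻; ∈-∃++; ∈-allFin)
open import Data.List.Relation.Binary.Subset.Propositional using (_⊆_)
open import Data.List.Relation.Unary.All as All using ([]; _∷_)
open import Data.List.Relation.Unary.AllPairs using ([]; _∷_)
open import Data.List.Relation.Unary.Any using (here; there)
open import Data.List.Relation.Unary.Unique.Propositional using (Unique)
open import Data.List.Relation.Unary.Unique.Propositional.Properties
  using (filter⁺; cartesianProduct⁺; allFin⁺)
open import Data.Nat.Base as ℕ using (zero; suc)
open import Data.Nat.Combinatorics using (_C_; nCk+nC[k+1]≡[n+1]C[k+1]; nC1≡n)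
import Data.Nat.Properties as ℕ
open import Data.Product.Base using (∃; _×_; _,_)
open import Data.Rational.Base hiding (_-_)
import Data.Rational.Base as ℚ
open import Data.Rational.Properties
open import Data.Rational.Solver using (module +-*-Solver)
open import Data.Rational.Unnormalised.Base as ℚᵘ using (mkℚᵘ; *≤*; *≡*)
import Data.Rational.Unnormalised.Properties as ℚᵘ
open import Data.Sum.Base using (inj₁; inj₂)
open import Data.Vec.Base using ([]; _∷_; here; there)
open import Level using (Level)
open import Relation.Binary.PropositionalEquality
  using (_≡_; refl; sym; trans; cong; cong₂; subst)
open import Relation.Nullary.Decidable using (yes; no; _×-dec_)
open import Relation.Nullary.Negation using (contradiction)
import Relation.Unary as U

open ℝ

private
  variable
    n : ℕ
    ℓ : Level

fromℕ-mono-≤ : ∀ {a b} → a ℕ.≤ b → fromℕ a ≤ fromℕ b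
fromℕ-mono-≤ {a} {b} a≤b = toℚᵘ-cancel-≤
  (ℚᵘ.≤-respˡ-≃ (ℚᵘ.≃-sym (toℚᵘ-fromℚᵘ (mkℚᵘ (+ a) 0)))
    (ℚᵘ.≤-respʳ-≃ (ℚᵘ.≃-sym (toℚᵘ-fromℚᵘ (mkℚᵘ (+ b) 0)))
      (*≤* (ℤ.*-monoʳ-≤-nonNeg (+ 1) (ℤ.+≤+ a≤b)))))

-- For variable arguments the normalisation inside `fromℕ` does not reduce, so the sum is computed
-- among unnormalised fractions with denominator 1 and carried back.
fromℕ-homo-+ : ∀ a b → fromℕ (a ℕ.+ b) ≡ fromℕ a + fromℕ b
fromℕ-homo-+ a b = toℚᵘ-injective (begin
  toℚᵘ (fromℕ (a ℕ.+ b))               ≈⟨ toℚᵘ-fromℚᵘ (mkℚᵘ (+ (a ℕ.+ b)) 0) ⟩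
  mkℚᵘ (+ (a ℕ.+ b)) 0                 ≈⟨ *≡* (cong (ℤ._* + 1) (cong₂ ℤ._+_ (ℤ.*-identityʳ (+ a)) (ℤ.*-identityʳ (+ b)))) ⟨
  mkℚᵘ (+ a) 0 ℚᵘ.+ mkℚᵘ (+ b) 0       ≈⟨ ℚᵘ.+-cong (toℚᵘ-fromℚᵘ (mkℚᵘ (+ a) 0)) (toℚᵘ-fromℚᵘ (mkℚᵘ (+ b) 0)) ⟨
  toℚᵘ (fromℕ a) ℚᵘ.+ toℚᵘ (fromℕ b)   ≈⟨ toℚᵘ-homo-+ (fromℕ a) (fromℕ b) ⟨
  toℚᵘ (fromℕ a + fromℕ b)             ∎)
  where open ℚᵘ.≃-Reasoning

0≤fromℕ : ∀ m → 0ℚ ≤ fromℕ m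
0≤fromℕ m = fromℕ-mono-≤ {0} {m} ℕ.z≤n

-- Induction that deletes one occurrence of the head `x` from `ys`: since `x` does not recur in
-- `xs`, the remaining entries all survive in `as ++ bs`.
length-⊆ : ∀ {a} {A : Set a} {xs ys : List A} → Unique xs → xs ⊆ ys → length xs ℕ.≤ length ys
length-⊆ {xs = []} _ _ = ℕ.z≤n
length-⊆ {xs = x ∷ xs} (x∉xs ∷ xs!) sub with as , bs , refl ← ∈-∃++ (sub (here refl)) = begin
  suc (length xs)                ≤⟨ ℕ.s≤s (length-⊆ xs! xs⊆) ⟩
  suc (length (as ++ bs))        ≡⟨ cong suc (length-++ as) ⟩
  suc (length as ℕ.+ length bs)  ≡⟨ ℕ.+-suc (length as) (length bs) ⟨
  length as ℕ.+ suc (length bs)  ≡⟨ length-++ as ⟨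
  length (as ++ x ∷ bs)          ∎
  where
  open ℕ.≤-Reasoning
  xs⊆ : xs ⊆ as ++ bs
  xs⊆ y∈ with ∈-++⁻ as (sub (there y∈))
  ... | inj₁ y∈as         = ∈-++⁺ˡ y∈as
  ... | inj₂ (here refl)  = contradiction refl (All.lookup x∉xs y∈)
  ... | inj₂ (there y∈bs) = ∈-++⁺ʳ as y∈bs

card-remove : {X : Subset n} {v : Fin n} → v ∈ X → card X ≡ suc (card (X - v))
-- Removing the head subtracts a singleton whose tail is `⊥`, so the tail becomes `X ─ ⊥`, which
-- still has to be identified with `X`.
card-remove {X = inside ∷ X} here = cong suc (cong card (sym (p─⊥≡p X)))
card-remove {X = inside  ∷ X} (there v∈X) = cong suc (card-remove v∈X)
card-remove {X = outside ∷ X} (there v∈X) = card-remove v∈X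

[1+k]C2≡k+kC2 : ∀ k → suc k C 2 ≡ k ℕ.+ k C 2
[1+k]C2≡k+kC2 k = trans (sym (nCk+nC[k+1]≡[n+1]C[k+1] k 1)) (cong (ℕ._+ k C 2) (nC1≡n k))

maxSubset-attained : (g : Subset n → ℚ) → ∃ λ X → maxSubset g ≡ g X
maxSubset-attained {zero}  g = [] , refl
maxSubset-attained {suc n} g
  with ⊔-sel (maxSubset λ X → g (inside ∷ X)) (maxSubset λ X → g (outside ∷ X))
... | inj₁ e = let X , eq = maxSubset-attained (λ X → g (inside ∷ X)) in inside ∷ X , trans e eq
... | inj₂ e = let X , eq = maxSubset-attained (λ X → g (outside ∷ X)) in outside ∷ X , trans e eq

≤maxSubset : (g : Subset n → ℚ) → ∀ X → g X ≤ maxSubset g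
≤maxSubset g []            = ≤-refl
≤maxSubset g (inside  ∷ X) = ≤-trans (≤maxSubset (λ X → g (inside ∷ X)) X)
  (p≤p⊔q (maxSubset (λ X → g (inside ∷ X))) (maxSubset (λ X → g (outside ∷ X))))
≤maxSubset g (outside ∷ X) = ≤-trans (≤maxSubset (λ X → g (outside ∷ X)) X)
  (p≤q⊔p (maxSubset (λ X → g (inside ∷ X))) (maxSubset (λ X → g (outside ∷ X))))

≤largest≤ : {P : ℕ → Set ℓ} (P? : U.Decidable P) → ∀ {m} b → m ℕ.≤ b → P m → m ℕ.≤ largest≤ P? b
≤largest≤ P? zero    m≤b pm = m≤b
≤largest≤ P? (suc b) m≤b pm with P? (suc b)
... | yes _ = m≤b
... | no ¬p with ℕ.m≤n⇒m<n∨m≡n m≤b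
...   | inj₁ (ℕ.s≤s m≤b′) = ≤largest≤ P? b m≤b′ pm
...   | inj₂ refl         = contradiction pm ¬p

-- The edge `uv` in the form in which `edges` lists it. The second branch also catches `u ≡ v`,
-- which cannot occur for adjacent vertices.
ordered : Fin n → Fin n → Fin n × Fin n
ordered u v with u Fin.<? v
... | yes _ = u , v
... | no  _ = v , u

ordered-< : {u v : Fin n} → u Fin.< v → ordered u v ≡ (u , v)
ordered-< {u = u} {v = v} u<v with u Fin.<? v
... | yes _  = refl
... | no u≮v = contradiction u<v u≮v

ordered-> : {u v : Fin n} → v Fin.< u → ordered u v ≡ (v , u)
ordered-> {u = u} {v = v} v<u with u Fin.<? v
... | yes u<v = contradiction v<u (Fin.<-asym u<v)
... | no _    = refl

module _ (G : Graph n) where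
  open Graph G

  edges-unique : Unique (edges G)
  edges-unique = filter⁺ _ (cartesianProduct⁺ (allFin⁺ n) (allFin⁺ n))

  -- An edge inside `X` either avoids `v` and lies in `X - v`, or joins `v` to one of its neighbours
  -- in `X`. Bounding `e G X` from above is what bounds the degree from below.
  e≤e-remove+degree : ∀ X v → e G X ℕ.≤ e G (X - v) ℕ.+ degree (Subgraph.adjᴴ? (induced G X)) v
  e≤e-remove+degree X v = begin
    e G X                                                  ≤⟨ length-⊆ (filter⁺ (inside? X) edges-unique) cover ⟩
    length (edgesIn (X - v) ++ map (ordered v) neighbours) ≡⟨ length-++ (edgesIn (X - v)) ⟩
    e G (X - v) ℕ.+ length (map (ordered v) neighbours)    ≡⟨ cong (e G (X - v) ℕ.+_) (length-map (ordered v) neighbours) ⟩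
    e G (X - v) ℕ.+ length neighbours                      ∎
    where
    open ℕ.≤-Reasoning

    inside? : ∀ Y → U.Decidable (λ ((u , w) : Fin n × Fin n) → u ∈ Y × w ∈ Y)
    inside? Y (u , w) = (u ∈? Y) ×-dec (w ∈? Y)

    edge? : U.Decidable (λ ((u , w) : Fin n × Fin n) → u Fin.< w × Adj u w)
    edge? (u , w) = (u Fin.<? w) ×-dec adj? u w

    neighbour? : U.Decidable (Subgraph.Adjᴴ (induced G X) v)
    neighbour? = Subgraph.adjᴴ? (induced G X) v

    edgesIn : Subset n → List (Fin n × Fin n)
    edgesIn Y = filter (inside? Y) (edges G)

    neighbours : List (Fin n)
    neighbours = filter neighbour? (allFin n)

    -- Listing the possible edges at v, rather than mapping these edges to their
    -- other ends, avoids an injectivity argument.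
    cover : edgesIn X ⊆ edgesIn (X - v) ++ map (ordered v) neighbours
    cover {u , w} uw∈
      with uw∈E , u∈X , w∈X ← ∈-filter⁻ (inside? X) {xs = edges G} uw∈
      with _ , u<w , uw ← ∈-filter⁻ edge? {xs = cartesianProduct (allFin n) (allFin n)} uw∈E
      with u Fin.≟ v | w Fin.≟ v
    ... | yes refl | _ = ∈-++⁺ʳ (edgesIn (X - v)) (subst (_∈ˡ map (ordered v) neighbours)
            (ordered-< u<w) (∈-map⁺ (ordered v) (∈-filter⁺ neighbour? (∈-allFin w) (u∈X , w∈X , uw))))
    -- Here `v` is the larger end, so `ordered` swaps the pair and the adjacency is reversed by
    -- symmetry.
    ... | no _ | yes refl = ∈-++⁺ʳ (edgesIn (X - v)) (subst (_∈ˡ map (ordered v) neighbours)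
            (ordered-> u<w) (∈-map⁺ (ordered v) (∈-filter⁺ neighbour? (∈-allFin u) (w∈X , u∈X , symm uw))))
    ... | no u≢v | no w≢v = ∈-++⁺ˡ (∈-filter⁺ (inside? (X - v)) uw∈E
            (x∈p∧x≢y⇒x∈p-y u∈X u≢v , x∈p∧x≢y⇒x∈p-y w∈X w≢v))

  -- As `0 C 2` is 0, only the edge count remains. Hence the maximum of δ is non-negative, which is
  -- used both to drop the absolute value in `Jumbled` and to control signs in the division by `j`.
  0≤δ⊥ : ∀ p → 0ℚ ≤ δ G p ⊥
  0≤δ⊥ p = subst (0ℚ ≤_) (sym eq) (0≤fromℕ (e G ⊥))
    where
    open +-*-Solver
    eq : δ G p ⊥ ≡ fromℕ (e G ⊥)
    eq = trans (cong (λ k → fromℕ (e G ⊥) ℚ.- p * fromℕ (k C 2)) (∣⊥∣≡0 n))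
      (solve 2 (λ x p → x :- p :* con 0ℚ := x) refl (fromℕ (e G ⊥)) p)

  δ-remove≤δ⇒≤degree : ∀ p {X v} → v ∈ X → δ G p (X - v) ≤ δ G p X →
    p * (fromℕ (card X) ℚ.- 1ℚ) ≤ fromℕ (degree (Subgraph.adjᴴ? (induced G X)) v)
  δ-remove≤δ⇒≤degree p {X} {v} v∈X δ≤ = begin
    p * (fromℕ (card X) ℚ.- 1ℚ)
      ≡⟨ cong (λ m → p * (m ℚ.- 1ℚ)) (trans (cong fromℕ (card-remove v∈X)) (fromℕ-homo-+ 1 k)) ⟩
    p * (1ℚ + K ℚ.- 1ℚ)
      -- With `card X ≡ suc k` the target is `p * K`. It is written as δ of `X - v` plus the
      -- correction `p * B + p * K - A`, which is carried along unchanged and finally cancels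
      -- everything except `D`.
      ≡⟨ solve 4 (λ p K A B → p :* (con 1ℚ :+ K :- con 1ℚ) := A :- p :* B :+ (p :* B :+ p :* K :- A)) refl p K A B ⟩
    A ℚ.- p * B + (p * B + p * K ℚ.- A)
      ≤⟨ +-monoˡ-≤ (p * B + p * K ℚ.- A) δ≤ ⟩
    δ G p X + (p * B + p * K ℚ.- A)
      ≡⟨ cong (λ m → E ℚ.- p * m + (p * B + p * K ℚ.- A)) cardC2 ⟩
    E ℚ.- p * (K + B) + (p * B + p * K ℚ.- A)
      ≤⟨ +-monoˡ-≤ (p * B + p * K ℚ.- A) (+-monoˡ-≤ (- (p * (K + B))) E≤A+D) ⟩
    A + D ℚ.- p * (K + B) + (p * B + p * K ℚ.- A)
      ≡⟨ solve 5 (λ p K A B D → A :+ D :- p :* (K :+ B) :+ (p :* B :+ p :* K :- A) := D) refl p K A B D ⟩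
    D ∎
    where
    open ≤-Reasoning
    open +-*-Solver
    k = card (X - v)
    K = fromℕ k
    A = fromℕ (e G (X - v))
    B = fromℕ (k C 2)
    D = fromℕ (degree (Subgraph.adjᴴ? (induced G X)) v)
    E = fromℕ (e G X)

    cardC2 : fromℕ (card X C 2) ≡ K + B
    cardC2 = trans (cong fromℕ (trans (cong (_C 2) (card-remove v∈X)) ([1+k]C2≡k+kC2 k)))
                   (fromℕ-homo-+ k (k C 2))

    E≤A+D : E ≤ A + D
    E≤A+D = subst (E ≤_) (fromℕ-homo-+ (e G (X - v)) _) (fromℕ-mono-≤ (e≤e-remove+degree X v))

  -- When `p` is the density, the conclusion is `Full (induced G X)` unfolded.
  δ-maximal⇒full : ∀ p X → (∀ Y → δ G p Y ≤ δ G p X) → ∀ v → v ∈ X →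
    p * (fromℕ (card X) ℚ.- 1ℚ) ≤ fromℕ (degree (Subgraph.adjᴴ? (induced G X)) v)
  δ-maximal⇒full p X maximal v v∈X = δ-remove≤δ⇒≤degree p v∈X (maximal (X - v))

  max-δ-attained : ∀ p → ∃ λ X → (∀ Y → δ G p Y ≤ δ G p X) × maxSubset (δ G p) ≡ δ G p X
  max-δ-attained p = let X , max≡ = maxSubset-attained (δ G p) in
    X , (λ Y → subst (δ G p Y ≤_) max≡ (≤maxSubset (δ G p) Y)) , max≡

  0≤max-δ : ∀ p → 0ℚ ≤ maxSubset (δ G p)
  0≤max-δ p = ≤-trans (0≤δ⊥ p) (≤maxSubset (δ G p) ⊥)

  -- A non-negative δ is its own absolute value. The separate `d` is later `disc⁺ G`, which equals δ
  -- at the maximiser.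
  jumbled⇒δ≤ᴿ : ∀ {p j d} X → 0ℚ ≤ d → d ≡ δ G p X → Jumbled p j G → fromℚ d ≤ᴿ fromℕ (card X) · j
  jumbled⇒δ≤ᴿ {j = j} X 0≤d refl jumbled =
    subst (λ d → fromℚ d ≤ᴿ fromℕ (card X) · j) (0≤p⇒∣p∣≡p 0≤d) (jumbled X)

-- Were `c * r < d`, then `c * r` would lie in the lower cut of `c · x`, giving some `a` below `x`
-- with `c * r < c * a`; but `a < r` and `c` is non-negative.
≤ᴿ-·⇒≤-*U : ∀ {c x d r} → 0ℚ ≤ c → fromℚ d ≤ᴿ c · x → U x r → d ≤ c * r
≤ᴿ-·⇒≤-*U {c} {x} {d} {r} 0≤c d≤cx ur = ≮⇒≥ λ cr<d →
  let a , _ , la , _ , cr<ca , _ = d≤cx (c * r) cr<d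
  in <-irrefl refl (<-≤-trans cr<ca (*-monoˡ-≤-nonNeg c {{nonNegative 0≤c}} (<⇒≤ (L<U x la ur))))

-- A rational below the quotient is below `d * a` for some `a` below `1/x`, so `d * a ≤ m` suffices.
-- That `a` comes with an `r` above `x` such that `a * r < 1`, and `d ≤ m * r` by the preceding
-- lemma.
÷ᴿ≤ᴿ : ∀ {d m x} (x>0 : 0ᴿ <ᴿ x) → 0ℚ ≤ d → 0ℚ ≤ m → fromℚ d ≤ᴿ m · x → d ÷ᴿ x ⟨ x>0 ⟩ ≤ᴿ fromℚ m
÷ᴿ≤ᴿ {d} {m} {x} (s , 0<s , ls) 0≤d 0≤m d≤mx q (a , _ , (r , ur , ar<1) , _ , q<da , _) =
  <-≤-trans q<da da≤m
  where
  open ≤-Reasoning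
  open +-*-Solver
  da≤m : d * a ≤ m
  da≤m with ≤-total 0ℚ a
  ... | inj₁ 0≤a = begin
    d * a        ≤⟨ *-monoʳ-≤-nonNeg a {{nonNegative 0≤a}} (≤ᴿ-·⇒≤-*U {x = x} 0≤m d≤mx ur) ⟩
    m * r * a    ≡⟨ solve 3 (λ m r a → m :* r :* a := m :* (a :* r)) refl m r a ⟩
    m * (a * r)  ≤⟨ *-monoˡ-≤-nonNeg m {{nonNegative 0≤m}} (<⇒≤ ar<1) ⟩
    m * 1ℚ       ≡⟨ *-identityʳ m ⟩
    m            ∎
  -- The lower cut of `1/x` also contains negative rationals, and multiplying by such an `a` would
  -- reverse `d ≤ m * r`; the signs of `d` and `m` settle this case.
  ... | inj₂ a≤0 = begin
    d * a        ≤⟨ *-monoˡ-≤-nonNeg d {{nonNegative 0≤d}} a≤0 ⟩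
    d * 0ℚ       ≡⟨ *-zeroʳ d ⟩
    0ℚ           ≤⟨ 0≤m ⟩
    m            ∎

-- With the instance left to be inferred, comparing types unfolds hasFull?, which is very slow.
full⇒card≤f : .{{nt : NonTrivial n}} (G : Graph n) (X : Subset n) → Full (induced G X) → card X ℕ.≤ f G
full⇒card≤f {n} {{nt}} G X full =
  ≤largest≤ {P = HasFull {{nt}} G} (hasFull? {{nt}} G) {card X} n (∣p∣≤n X) (induced G X , full , refl)

theorem3 : ∀ (n : ℕ) .{{_ : NonTrivial n}} (G : Graph n) (j : ℝ) (j>0 : 0ᴿ <ᴿ j) →
    Jumbled (density G) j G →
    fromℚ (fromℕ (f G)) ≥ᴿ disc⁺ G ÷ᴿ j ⟨ j>0 ⟩
theorem3 n {{nt}} G j j>0 jumbled = bound (max-δ-attained G (density {{nt}} G))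
  where
  0≤disc⁺ : 0ℚ ≤ disc⁺ {{nt}} G
  0≤disc⁺ = 0≤max-δ G (density {{nt}} G)

  bound : (∃ λ X → (∀ Y → δ G (density {{nt}} G) Y ≤ δ G (density {{nt}} G) X) ×
                   disc⁺ {{nt}} G ≡ δ G (density {{nt}} G) X) →
          disc⁺ {{nt}} G ÷ᴿ j ⟨ j>0 ⟩ ≤ᴿ fromℚ (fromℕ (f {{nt}} G))
  -- The order on cuts is tested at a rational `q`: the division by `j` gives `q < card X`, and
  -- fullness of `X` lifts this to `f G`.
  bound (X , maximal , disc≡) q q<disc/j = <-≤-trans {q} {fromℕ (card X)} {fromℕ (f {{nt}} G)}
    (÷ᴿ≤ᴿ {disc⁺ {{nt}} G} {fromℕ (card X)} {j} j>0 0≤disc⁺ (0≤fromℕ (card X)) disc≤ q q<disc/j)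
    (fromℕ-mono-≤ {card X} {f {{nt}} G} (full⇒card≤f {{nt}} G X (δ-maximal⇒full G (density {{nt}} G) X maximal)))
    where
    disc≤ : fromℚ (disc⁺ {{nt}} G) ≤ᴿ fromℕ (card X) · j
    disc≤ = jumbled⇒δ≤ᴿ G {density {{nt}} G} {j} {disc⁺ {{nt}} G} X 0≤disc⁺ disc≡ jumbled
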